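{- There is a constant $c>0$ such that for all sufficiently large integers $n \ge 2$, every $\mathsf{SBC}^-$ proof of the bit pigeonhole principle $\mathrm{BPHP}_n$ has size at least $2^{c n}$; that is, $\mathrm{BPHP}_n$ requires $\mathsf{SBC}^-$ proofs of size $2^{\Omega(n)}$.
   Context: A literal is a variable $v$ or its negation $\bar v$. A clause is a nontautological set of literals (no complementary pair), read as a disjunction; $\bot$ is the empty clause; a formula is a finite set of clauses (a CNF); $\mathrm{var}(\Gamma)$ is the set of variables occurring in $\Gamma$. For a set $L$ of literals, $\bar L=\{\bar\ell:\ell\in L\}$. A clause $D$ is a weakening of $C$ if $C\subseteq D$. If $C\cup\{x\}$ and $D\cup\{\bar x\}$ are clauses with $x,\bar x\notin C\cup D$ and $C\cup D$ nontautological, then $C\cup D$ is their resolvent on $x$. A clause $C$ is a set-blocked clause (SBC) for a nonempty $L\subseteq C$ with respect to a formula $\Gamma$ if for every $D\in\Gamma$ with $D\cap\bar L\neq\varnothing$ and $D\cap L=\varnothing$, the set $(C\setminus L)\cup(D\setminus\bar L)$ is tautological; $C$ is an SBC w.r.t. $\Gamma$ if it is one for some such $L$. An $\mathsf{SBC}$ proof of $\Gamma$ is a sequence of formulas $(\Gamma_1,\dots,\Gamma_N)$ with $\Gamma_1=\Gamma$, $\bot\in\Gamma_N$, and for each $i<N$, $\Gamma_{i+1}=\Gamma_i\cup\{C\}$ where $C$ is a resolvent of two clauses of $\Gamma_i$, a weakening of a clause of $\Gamma_i$, or an SBC with respect to $\Gamma_i$. Its size is $N$. An $\mathsf{SBC}^-$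 proof of $\Gamma$ is an $\mathsf{SBC}$ proof of $\Gamma$ in which every variable occurring anywhere in the proof belongs to $\mathrm{var}(\Gamma)$. Bit pigeonhole principle: for $n=2^k$, $k\ge1$, take variables $p^x_\ell$ for $x\in[n+1]$, $\ell\in[k]$. For a variable $v$, write "$v\neq 0$" for the literal $v$ and "$v\neq1$" for $\bar v$. Then $\mathrm{BPHP}_n$ is the set of clauses $\bigvee_{\ell=1}^k (p^x_\ell\neq h_\ell)\vee\bigvee_{\ell=1}^k(p^y_\ell\neq h_\ell)$ over all $x,y\in[n+1]$ with $x\neq y$ and all $(h_1,\dots,h_k)\in\{0,1\}^k$. For an arbitrary integer $n\ge2$ that is not a power of two, $\mathrm{BPHP}_n$ is defined to be $\mathrm{BPHP}_m$ where $m$ is the largest power of two not exceeding $n$. -}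

module Defs where

open import Data.Nat using (ℕ; zero; suc; _+_; _*_; _^_; _≤_)
open import Data.Nat.Logarithm using (⌊log₂_⌋)
open import Data.Bool using (Bool; true; false; not)
open import Data.Fin using (Fin; toℕ)
open import Data.List using (List; []; _∷_; map; allFin; _++_; length)
open import Data.List.Membership.Propositional using (_∈_)
open import Data.Product using (Σ; ∃; _×_; _,_)
open import Data.Sum using (_⊎_)
open import Data.Unit using (⊤)
open import Relation.Nullary using (¬_)
open import Relation.Binary.PropositionalEquality using (_≡_; _≢_)

-- A literal over variable type V: (v , true) is v, (v , false) is v̄.
Lit : Set → Set
Lit V = V × Bool

neg : {V : Set} → Lit V → Lit V
neg (v , b) = (v , not b)

-- Clauses are represented by lists of literals, read as sets (only
-- membership is ever used, except in the concrete BPHP clauses).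
Clause : Set → Set
Clause V = List (Lit V)

TautP : {V : Set} → (Lit V → Set) → Set
TautP {V} S = Σ (Lit V) λ l → S l × S (neg l)

Taut : {V : Set} → Clause V → Set
Taut C = TautP (λ l → l ∈ C)

IsClause : {V : Set} → Clause V → Set
IsClause C = ¬ Taut C

Formula : Set → Set₁
Formula V = Clause V → Set

VarOf : {V : Set} → Formula V → V → Set
VarOf {V} Γ v = Σ (Clause V) λ C → Γ C × Σ Bool λ b → (v , b) ∈ C

_∪ᶠ_ : {V : Set} → Formula V → List (Clause V) → Formula V
(Γ ∪ᶠ cs) D = Γ D ⊎ D ∈ cs

-- E is a resolvent of C₁ = C ∪ {x} and C₂ = D ∪ {x̄} on x:
-- E = (C₁ ∖ {x}) ∪ (C₂ ∖ {x̄}) as sets, and E is nontautological.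
-- (x̄ ∉ C₁ and x ∉ C₂ follow from C₁, C₂ being clauses.)
IsResolvent : {V : Set} → Clause V → Clause V → Clause V → Set
IsResolvent {V} E C₁ C₂ =
  Σ (Lit V) λ x → x ∈ C₁ × neg x ∈ C₂ ×
    ((l : Lit V) → (l ∈ E → ((l ∈ C₁ × l ≢ x) ⊎ (l ∈ C₂ × l ≢ neg x)))
                 × (((l ∈ C₁ × l ≢ x) ⊎ (l ∈ C₂ × l ≢ neg x)) → l ∈ E))
    × IsClause E

IsWeakening : {V : Set} → Clause V → Clause V → Set
IsWeakening {V} D C = (l : Lit V) → l ∈ C → l ∈ D

IsSBCFor : {V : Set} → Formula V → Clause V → List (Lit V) → Set
IsSBCFor {V} Γ C L =
  (Σ (Lit V) λ l → l ∈ L) ×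
  ((l : Lit V) → l ∈ L → l ∈ C) ×
  ((D : Clause V) → Γ D →
     (Σ (Lit V) λ l → l ∈ D × neg l ∈ L) →
     ((l : Lit V) → l ∈ D → ¬ (l ∈ L)) →
     TautP (λ l → (l ∈ C × ¬ (l ∈ L)) ⊎ (l ∈ D × ¬ (neg l ∈ L))))

IsSBC : {V : Set} → Formula V → Clause V → Set
IsSBC {V} Γ C = Σ (List (Lit V)) λ L → IsSBCFor Γ C L

Derivable : {V : Set} → Formula V → Clause V → Set
Derivable {V} Γᵢ C =
  IsClause C ×
  ( (Σ (Clause V) λ C₁ → Σ (Clause V) λ C₂ → Γᵢ C₁ × Γᵢ C₂ × IsResolvent C C₁ C₂)
  ⊎ (Σ (Clause V) λ C₀ → Γᵢ C₀ × IsWeakening C C₀)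
  ⊎ IsSBC Γᵢ C )

-- A sequence of added clauses, listed most recent first:
-- cs = Cₙ ∷ … ∷ C₁ ∷ [], where Γᵢ₊₁ = Γ ∪ {C₁,…,Cᵢ}.
ValidSteps : {V : Set} → Formula V → List (Clause V) → Set
ValidSteps Γ [] = ⊤
ValidSteps Γ (C ∷ cs) = ValidSteps Γ cs × Derivable (Γ ∪ᶠ cs) C

-- An SBC proof of Γ (the sequence Γ₁ = Γ, Γ₂, …, Γ_N with N = 1 + length cs)
IsSBCProof : {V : Set} → Formula V → List (Clause V) → Set
IsSBCProof {V} Γ cs =
  ValidSteps Γ cs × Σ (Clause V) λ C → (Γ ∪ᶠ cs) C × C ≡ []

-- Size of the proof = number N of formulas in the sequence.
proofSize : {V : Set} → List (Clause V) → ℕ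
proofSize cs = suc (length cs)

IsSBCMinusProof : {V : Set} → Formula V → List (Clause V) → Set
IsSBCMinusProof {V} Γ cs =
  IsSBCProof Γ cs ×
  ((C : Clause V) → C ∈ cs → (v : V) (b : Bool) → (v , b) ∈ C → VarOf Γ v)

-- Bit pigeonhole principle.  Variable p^x_ℓ is the pair (x , ℓ) with
-- pigeon x ∈ {0..m} and bit ℓ ∈ {0..k-1} (0-indexed).
-- k = ⌊log₂ n⌋, m = 2^k (the largest power of two ≤ n).
-- "p ≠ h" is the literal p when h = 0 (false), p̄ when h = 1 (true).
bphpK : ℕ → ℕ
bphpK n = ⌊log₂ n ⌋

pigeonLits : (k m : ℕ) → Fin (suc m) → (Fin k → Bool) → Clause (ℕ × ℕ)
pigeonLits k m x h = map (λ ℓ → ((toℕ x , toℕ ℓ) , not (h ℓ))) (allFin k)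

BPHP : ℕ → Formula (ℕ × ℕ)
BPHP n C =
  Σ (Fin (suc (2 ^ bphpK n))) λ x →
  Σ (Fin (suc (2 ^ bphpK n))) λ y →
  x ≢ y × Σ (Fin (bphpK n) → Bool) λ h →
  C ≡ pigeonLits (bphpK n) (2 ^ bphpK n) x h ++ pigeonLits (bphpK n) (2 ^ bphpK n) y h

{-# OPTIONS --safe #-}

-- If C is blocked by L, then making L true and C ∖ L false satisfies every
-- clause that meets the variables of L.  For the bit pigeonhole principle this
-- forces C to mention all pigeons.  If the proof is short, some matching ρ of at
-- most s = 2^k / 8 pigeons satisfies all its clauses that mention at least 7s
-- pigeons, in particular the set-blocked ones: choose ρ greedily, some pair
-- always satisfying a quarter of the remaining clauses.  What is left is a
-- resolution refutation whose clauses always leave a hole free, so one can walk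
-- from the empty clause to an axiom, maintaining a matching that extends ρ and
-- falsifies the current clause; but no matching falsifies an axiom.

module Submission where

open import Defs
open import Data.Bool using (Bool; true; false; not)
import Data.Bool.Properties as Bool
open import Data.Fin as Fin using (Fin; toℕ)
open import Data.Fin.Properties as Fin using (toℕ-injective)
open import Data.List using (List; []; _∷_; [_]; map; filter; length; allFin; cartesianProduct; _++_)
open import Data.List.Membership.Propositional using (_∈_; _∉_)
open import Data.List.Membership.Propositional.Properties
  using (∈-++⁺ˡ; ∈-++⁺ʳ; ∈-++⁻; ∈-map⁺; ∈-map⁻; ∈-filter⁺; ∈-filter⁻; ∈-allFin; ∈-∃++; ∈-cartesianProduct⁻)
import Data.List.Membership.DecPropositional as DecMembership
open import Data.List.Properties using (length-++; length-map; length-filter; filter-++; filter-all; filter-none; filter-accept; filter-reject; length-tabulate)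
open import Data.List.Relation.Binary.Permutation.Propositional using (_↭_; ↭-refl; ↭-trans; ↭⇒↭ₛ)
open import Data.List.Relation.Binary.Permutation.Propositional.Properties using (↭-length; filter-↭; ∈-resp-↭; shift; ++⁺ˡ)
import Data.List.Relation.Binary.Permutation.Setoid.Properties as PermutationSetoid
open import Data.List.Relation.Unary.All as All using (All; []; _∷_)
import Data.List.Relation.Unary.All.Properties as All
open import Data.List.Relation.Unary.AllPairs as AllPairs using (AllPairs; []; _∷_)
import Data.List.Relation.Unary.AllPairs.Properties as AllPairs
open import Data.List.Relation.Unary.Any using (here; there)
open import Data.List.Relation.Unary.Unique.Propositional using (Unique)
import Data.List.Relation.Unary.Unique.Propositional.Properties as Unique
open import Data.Nat using (ℕ; zero; suc; _+_; _*_; _^_; _≤_; _<_; z≤n; s≤s; _≤?_)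
open import Data.Nat.ListAction using (sum)
open import Data.Nat.Logarithm using (⌊log₂_⌋; ⌊log₂⌋-mono-≤; ⌊log₂[2^n]⌋≡n)
open import Data.Nat.Properties
open import Data.Nat.Tactic.RingSolver using (solve-∀)
open import Data.Product using (Σ; ∃; ∃₂; _×_; _,_; proj₁; proj₂)
open import Data.Product.Properties using (≡-dec; ,-injectiveˡ; ,-injectiveʳ)
open import Data.Sum using (_⊎_; inj₁; inj₂; [_,_]′)
open import Data.Vec using (Vec; []; _∷_; lookup; tabulate)
open import Data.Vec.Properties as Vec using (tabulate-cong; tabulate∘lookup; ∷-injectiveʳ)
open import Function using (_∘_; id; case_of_)
open import Relation.Binary.PropositionalEquality hiding ([_])
open import Relation.Nullary using (¬_; Dec; yes; no; contradiction)
open import Relation.Nullary.Decidable using (map′; _⊎-dec_; ¬?)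
open import Relation.Unary using (Decidable)

-- Arithmetic of the greedy rounds

+-swap : ∀ x y z → x + (y + z) ≡ y + (x + z)
+-swap = solve-∀

*-swap : ∀ x y z → x * (y * z) ≡ y * (x * z)
*-swap = solve-∀

-- The left side bounds the number of free pairs, and `6 * s * (3 * s)` is the least number of them
-- that satisfy a given wide clause: this is where the quarter in the greedy choice comes from.
regroup : ∀ s → 9 * s * (8 * s) ≡ 4 * (6 * s * (3 * s))
regroup = solve-∀

three-quarters : ∀ a b u → u ≤ 4 * a → a + b ≡ u → 4 * b ≤ 3 * u
three-quarters a b u u≤4a a+b≡u = +-cancelˡ-≤ u _ _ (begin
  u + 4 * b       ≤⟨ +-monoˡ-≤ (4 * b) u≤4a ⟩
  4 * a + 4 * b   ≡⟨ *-distribˡ-+ 4 a b ⟨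
  4 * (a + b)     ≡⟨ cong (4 *_) a+b≡u ⟩
  4 * u           ∎)
  where open ≤-Reasoning

-- Powers of 4 and 3 are kept on opposite sides, so that decay by 3/4 per round needs no division.
iterate-bound : ∀ i {u v n} → 4 * v ≤ 3 * u → 4 ^ i * u ≤ 3 ^ i * n → 4 ^ suc i * v ≤ 3 ^ suc i * n
iterate-bound i {u} {v} {n} step bound = begin
  4 * 4 ^ i * v     ≡⟨ *-assoc 4 (4 ^ i) v ⟩
  4 * (4 ^ i * v)   ≡⟨ *-swap 4 (4 ^ i) v ⟩
  4 ^ i * (4 * v)   ≤⟨ *-monoʳ-≤ (4 ^ i) step ⟩
  4 ^ i * (3 * u)   ≡⟨ *-swap (4 ^ i) 3 u ⟩
  3 * (4 ^ i * u)   ≤⟨ *-monoʳ-≤ 3 bound ⟩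
  3 * (3 ^ i * n)   ≡⟨ *-assoc 3 (3 ^ i) n ⟨
  3 ^ suc i * n     ∎
  where open ≤-Reasoning

-- Counting in lists

count : {A : Set} {P : A → Set} → Decidable P → List A → ℕ
count P? xs = length (filter P? xs)

module _ {A : Set} {P : A → Set} (P? : Decidable P) where

  count-yes : ∀ {x} xs → P x → count P? (x ∷ xs) ≡ suc (count P? xs)
  count-yes xs px = cong length (filter-accept P? px)

  count-no : ∀ {x} xs → ¬ P x → count P? (x ∷ xs) ≡ count P? xs
  count-no xs ¬px = cong length (filter-reject P? ¬px)

  count-++ : ∀ xs ys → count P? (xs ++ ys) ≡ count P? xs + count P? ys
  count-++ xs ys = trans (cong length (filter-++ P? xs ys)) (length-++ (filter P? xs))

  count-map : {B : Set} (f : B → A) → ∀ xs → count P? (map f xs) ≡ count (P? ∘ f) xs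
  count-map f [] = refl
  count-map f (x ∷ xs) with P? (f x)
  ... | yes _ = cong suc (count-map f xs)
  ... | no  _ = count-map f xs

  count-mono : {Q : A → Set} (Q? : Decidable Q) → (∀ {x} → P x → Q x) → ∀ xs → count P? xs ≤ count Q? xs
  count-mono Q? P⊆Q [] = z≤n
  count-mono Q? P⊆Q (x ∷ xs) with P? x | Q? x
  ... | yes _  | yes _  = s≤s (count-mono Q? P⊆Q xs)
  ... | yes px | no ¬qx = contradiction (P⊆Q px) ¬qx
  ... | no _   | yes _  = m≤n⇒m≤1+n (count-mono Q? P⊆Q xs)
  ... | no _   | no _   = count-mono Q? P⊆Q xs

  count+count-¬ : ∀ xs → count P? xs + count (¬? ∘ P?) xs ≡ length xs
  count+count-¬ [] = refl
  count+count-¬ (x ∷ xs) with P? x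
  ... | yes _ = cong suc (count+count-¬ xs)
  ... | no _  = trans (+-suc _ _) (cong suc (count+count-¬ xs))

  -- Deleting the entries of `xs` lowers a count by at most their number. It is applied to the
  -- pigeons and the holes that a matching has used up.
  count-complement : ∀ xs {ys zs} → ys ↭ xs ++ zs → count P? ys ≤ length xs + count P? zs
  count-complement xs {ys} {zs} p = begin
    count P? ys               ≡⟨ ↭-length (filter-↭ P? p) ⟩
    count P? (xs ++ zs)       ≡⟨ count-++ xs zs ⟩
    count P? xs + count P? zs ≤⟨ +-monoˡ-≤ _ (length-filter P? xs) ⟩
    length xs + count P? zs   ∎
    where open ≤-Reasoning

module _ {A B : Set} {Q : A × B → Set} (Q? : Decidable Q) {M : A → Set} (M? : Decidable M)
         (ys : List B) (w : ℕ) (w≤ : ∀ {x} → M x → w ≤ count (λ y → Q? (x , y)) ys) where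

  count-cartesianProduct : ∀ xs → count M? xs * w ≤ count Q? (cartesianProduct xs ys)
  count-cartesianProduct [] = z≤n
  count-cartesianProduct (x ∷ xs) = subst (count M? (x ∷ xs) * w ≤_) (sym split) (step (M? x))
    where
    split : count Q? (cartesianProduct (x ∷ xs) ys)
          ≡ count (λ y → Q? (x , y)) ys + count Q? (cartesianProduct xs ys)
    split = trans (count-++ Q? (map (x ,_) ys) _) (cong (_+ _) (count-map Q? (x ,_) ys))
    step : Dec (M x) → count M? (x ∷ xs) * w ≤ count (λ y → Q? (x , y)) ys + count Q? (cartesianProduct xs ys)
    step (yes mx) rewrite count-yes M? xs mx = +-mono-≤ (w≤ mx) (count-cartesianProduct xs)
    step (no ¬mx) rewrite count-no M? xs ¬mx = ≤-trans (count-cartesianProduct xs) (m≤n+m _ _)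

length-cartesianProduct : {A B : Set} (xs : List A) (ys : List B) →
                          length (cartesianProduct xs ys) ≡ length xs * length ys
length-cartesianProduct [] ys = refl
length-cartesianProduct (x ∷ xs) ys =
  trans (length-++ (map (x ,_) ys)) (cong₂ _+_ (length-map _ ys) (length-cartesianProduct xs ys))

module _ {A B : Set} {R : A → B → Set} (R? : ∀ a b → Dec (R a b)) where

  -- Turns "every clause is satisfied by many pairs" into "on average a pair satisfies many
  -- clauses".
  double-count : ∀ as bs → sum (map (λ a → count (R? a) bs) as) ≡ sum (map (λ b → count (λ a → R? a b) as) bs)
  double-count [] bs = sym (zeros bs)
    where
    zeros : ∀ bs → sum (map (λ b → count (λ a → R? a b) []) bs) ≡ 0
    zeros [] = refl
    zeros (_ ∷ bs) = zeros bs
  double-count (a ∷ as) bs = trans (cong (count (R? a) bs +_) (double-count as bs)) (sym (add bs))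
    where
    f : B → ℕ
    f b = count (λ a → R? a b) as
    add : ∀ bs → sum (map (λ b → count (λ a → R? a b) (a ∷ as)) bs) ≡ count (R? a) bs + sum (map f bs)
    add [] = refl
    add (b ∷ bs) with R? a b
    ... | no _  rewrite add bs = +-swap (f b) (count (R? a) bs) _
    ... | yes _ rewrite add bs = cong suc (+-swap (f b) (count (R? a) bs) _)

sum-≥ : {A : Set} (f : A → ℕ) (w : ℕ) (xs : List A) → (∀ {x} → x ∈ xs → w ≤ f x) →
        length xs * w ≤ sum (map f xs)
sum-≥ f w [] _ = z≤n
sum-≥ f w (x ∷ xs) h = +-mono-≤ (h (here refl)) (sum-≥ f w xs (h ∘ there))

-- If the first entry falls short of `b`, cancelling `b` leaves the same hypothesis for the rest.
-- The factor `c` replaces a division. An empty list would satisfy the inequality without offering a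
-- witness.
averaging : {A : Set} (c b : ℕ) (f : A → ℕ) (xs : List A) → 0 < length xs →
            length xs * b ≤ c * sum (map f xs) → ∃ λ x → x ∈ xs × b ≤ c * f x
averaging {A} c b f (x ∷ xs) _ = go x xs
  where
  go : ∀ x xs → length (x ∷ xs) * b ≤ c * sum (map f (x ∷ xs)) → ∃ λ y → y ∈ x ∷ xs × b ≤ c * f y
  go x [] h = x , here refl , subst₂ _≤_ (+-identityʳ b) (cong (c *_) (+-identityʳ (f x))) h
  go x (y ∷ ys) h with b ≤? c * f x
  ... | yes b≤ = x , here refl , b≤
  ... | no b≰ =
    let z , z∈ , b≤ = go y ys (+-cancelˡ-≤ b _ _ (begin
          b + length (y ∷ ys) * b                  ≤⟨ h ⟩
          c * (f x + sum (map f (y ∷ ys)))         ≡⟨ *-distribˡ-+ c (f x) _ ⟩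
          c * f x + c * sum (map f (y ∷ ys))       ≤⟨ +-monoˡ-≤ _ (<⇒≤ (≰⇒> b≰)) ⟩
          b + c * sum (map f (y ∷ ys))             ∎))
    in z , there z∈ , b≤
    where open ≤-Reasoning

-- Each new `x` is not in `xs`, so it lies in the complement found so far and can be cut out of it.
-- Having a permutation, and not just a set difference, makes lengths and counts add up.
∃-complement : {A : Set} {xs ys : List A} → Unique xs → (∀ {x} → x ∈ xs → x ∈ ys) →
               ∃ λ zs → ys ↭ xs ++ zs
∃-complement {ys = ys} [] _ = ys , ↭-refl
∃-complement {xs = x ∷ xs} (x∉xs ∷ xs!) xs⊆ys with ∃-complement xs! (xs⊆ys ∘ there)
... | zs , p with ∈-++⁻ xs (∈-resp-↭ p (xs⊆ys (here refl)))
...   | inj₁ x∈xs = contradiction refl (All.lookup x∉xs x∈xs)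
...   | inj₂ x∈zs with ∈-∃++ x∈zs
...     | as , bs , refl = as ++ bs , ↭-trans p (↭-trans (++⁺ˡ xs (shift x as bs)) (shift x xs (as ++ bs)))

Unique-++⇒∉ : {A : Set} (xs : List A) {zs : List A} → Unique (xs ++ zs) → ∀ {z} → z ∈ zs → z ∉ xs
Unique-++⇒∉ (x ∷ xs) (x∉ ∷ _) z∈zs (here refl)  = All.lookup x∉ (∈-++⁺ʳ xs z∈zs) refl
Unique-++⇒∉ (x ∷ xs) (_ ∷ u)  z∈zs (there z∈xs) = Unique-++⇒∉ xs u z∈zs z∈xs

complement-∉ : {A : Set} {xs ys zs : List A} → Unique ys → ys ↭ xs ++ zs → ∀ {z} → z ∈ zs → z ∉ xs
complement-∉ {xs = xs} ys! p =
  Unique-++⇒∉ xs (PermutationSetoid.Unique-resp-↭ (setoid _) (↭⇒↭ₛ p) ys!)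

Unique-length-≤ : {A : Set} {xs ys : List A} → Unique xs → (∀ {x} → x ∈ xs → x ∈ ys) → length xs ≤ length ys
Unique-length-≤ {xs = xs} xs! xs⊆ys with ∃-complement xs! xs⊆ys
... | zs , p = subst (length xs ≤_) (sym (trans (↭-length p) (length-++ xs))) (m≤m+n _ _)

-- Holes as bit vectors

allHoles : ∀ k → List (Vec Bool k)
allHoles zero    = [ [] ]
allHoles (suc k) = map (true ∷_) (allHoles k) ++ map (false ∷_) (allHoles k)

∈-allHoles : ∀ {k} (h : Vec Bool k) → h ∈ allHoles k
∈-allHoles [] = here refl
∈-allHoles (true  ∷ h) = ∈-++⁺ˡ (∈-map⁺ _ (∈-allHoles h))
∈-allHoles (false ∷ h) = ∈-++⁺ʳ _ (∈-map⁺ _ (∈-allHoles h))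

allHoles-unique : ∀ k → Unique (allHoles k)
allHoles-unique zero = [] ∷ []
allHoles-unique (suc k) =
  Unique.++⁺ (Unique.map⁺ ∷-injectiveʳ (allHoles-unique k)) (Unique.map⁺ ∷-injectiveʳ (allHoles-unique k)) disjoint
  where
  disjoint : ∀ {h} → ¬ (h ∈ map (true ∷_) (allHoles k) × h ∈ map (false ∷_) (allHoles k))
  disjoint (p , q) with ∈-map⁻ (true ∷_) p | ∈-map⁻ (false ∷_) q
  ... | _ , _ , refl | _ , _ , ()

2*m≡m+m : ∀ m → 2 * m ≡ m + m
2*m≡m+m m = cong (m +_) (+-identityʳ m)

length-allHoles : ∀ k → length (allHoles k) ≡ 2 ^ k
length-allHoles zero = refl
length-allHoles (suc k) = begin
  length (allHoles (suc k))                    ≡⟨ length-++ (map (true ∷_) (allHoles k)) ⟩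
  length (map (true ∷_) (allHoles k)) + length (map (false ∷_) (allHoles k))
    ≡⟨ cong₂ _+_ (length-map _ (allHoles k)) (length-map _ (allHoles k)) ⟩
  length (allHoles k) + length (allHoles k)    ≡⟨ cong₂ _+_ (length-allHoles k) (length-allHoles k) ⟩
  2 ^ k + 2 ^ k                                ≡⟨ 2*m≡m+m (2 ^ k) ⟨
  2 ^ suc k                                    ∎
  where open ≡-Reasoning

bit? : ∀ {k} (ℓ : Fin k) (b : Bool) → Decidable (λ (h : Vec Bool k) → lookup h ℓ ≡ b)
bit? ℓ b h = lookup h ℓ Bool.≟ b

-- The first bit is constant on each half of `allHoles`, with opposite values; a later bit is evenly
-- split inside each half by induction.
count-bit : ∀ {k} (ℓ : Fin k) b → 2 * count (bit? ℓ b) (allHoles k) ≡ 2 ^ k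
count-bit {suc k} ℓ b = cong (2 *_) (begin
  count (bit? ℓ b) (allHoles (suc k))  ≡⟨ count-++ (bit? ℓ b) (map (true ∷_) (allHoles k)) _ ⟩
  count (bit? ℓ b) (map (true ∷_) (allHoles k)) + count (bit? ℓ b) (map (false ∷_) (allHoles k))
    ≡⟨ cong₂ _+_ (count-map (bit? ℓ b) (true ∷_) (allHoles k)) (count-map (bit? ℓ b) (false ∷_) (allHoles k)) ⟩
  count (bit? ℓ b ∘ (true ∷_)) (allHoles k) + count (bit? ℓ b ∘ (false ∷_)) (allHoles k)
    ≡⟨ halves ℓ b ⟩
  2 ^ k ∎)
  where
  open ≡-Reasoning
  halves : ∀ ℓ b → count (bit? ℓ b ∘ (true ∷_)) (allHoles k) + count (bit? ℓ b ∘ (false ∷_)) (allHoles k) ≡ 2 ^ k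
  halves Fin.zero true  = trans (cong₂ _+_
    (cong length (filter-all  (bit? Fin.zero true ∘ (true ∷_))  (All.universal (λ _ → refl) (allHoles k))))
    (cong length (filter-none (bit? Fin.zero true ∘ (false ∷_)) (All.universal (λ _ ()) (allHoles k)))))
    (trans (+-identityʳ _) (length-allHoles k))
  halves Fin.zero false = trans (cong₂ _+_
    (cong length (filter-none (bit? Fin.zero false ∘ (true ∷_))  (All.universal (λ _ ()) (allHoles k))))
    (cong length (filter-all  (bit? Fin.zero false ∘ (false ∷_)) (All.universal (λ _ → refl) (allHoles k)))))
    (length-allHoles k)
  halves (Fin.suc ℓ) b = trans (sym (2*m≡m+m (count (bit? ℓ b) (allHoles k)))) (count-bit ℓ b)

-- Clauses and partial matchings

Var : Set
Var = ℕ × ℕ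

_≟ˡ_ : (l m : Lit Var) → Dec (l ≡ m)
_≟ˡ_ = ≡-dec (≡-dec _≟_ _≟_) Bool._≟_

open DecMembership _≟ˡ_ using () renaming (_∈?_ to _∈ˡ?_)

neg-neg : {V : Set} (l : Lit V) → neg (neg l) ≡ l
neg-neg (v , true)  = refl
neg-neg (v , false) = refl

-- `BPHP n` unfolds to `bitPHP (bphpK n)`; fixing the number of bits keeps the logarithm out of the
-- argument.
bitPHP : ℕ → Formula Var
bitPHP k C = Σ (Fin (suc (2 ^ k))) λ x → Σ (Fin (suc (2 ^ k))) λ y → x ≢ y × Σ (Fin k → Bool) λ h →
  C ≡ pigeonLits k (2 ^ k) x h ++ pigeonLits k (2 ^ k) y h

module BitPHP (k : ℕ) where

  Pigeon : Set
  Pigeon = Fin (suc (2 ^ k))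

  Hole : Set
  Hole = Vec Bool k

  Pair : Set
  Pair = Pigeon × Hole

  lit : Pigeon → Fin k → Bool → Lit Var
  lit x ℓ b = (toℕ x , toℕ ℓ) , b

  lit-injective : ∀ {x ℓ b y ℓ′ b′} → lit x ℓ b ≡ lit y ℓ′ b′ → x ≡ y × ℓ ≡ ℓ′ × b ≡ b′
  lit-injective e = toℕ-injective (,-injectiveˡ (,-injectiveˡ e)) ,
                    toℕ-injective (,-injectiveʳ (,-injectiveˡ e)) , ,-injectiveʳ e

  allPigeons : List Pigeon
  allPigeons = allFin (suc (2 ^ k))

  Mentions : Clause Var → Pigeon → Set
  Mentions C x = ∃₂ λ ℓ b → lit x ℓ b ∈ C

  opaque

    mentions? : ∀ C → Decidable (Mentions C)
    mentions? C x = Fin.any? λ ℓ → map′ [ true ,_ , false ,_ ]′ split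
                      ((lit x ℓ true ∈ˡ? C) ⊎-dec (lit x ℓ false ∈ˡ? C))
      where
      split : ∀ {ℓ} → (∃ λ b → lit x ℓ b ∈ C) → lit x ℓ true ∈ C ⊎ lit x ℓ false ∈ C
      split (true  , p) = inj₁ p
      split (false , p) = inj₂ p

  width : Clause Var → ℕ
  width C = count (mentions? C) allPigeons

  Local : Clause Var → Set
  Local C = ∀ v b → (v , b) ∈ C → VarOf (bitPHP k) v

  ∈-pigeonLits⁻ : ∀ x h {l} → l ∈ pigeonLits k (2 ^ k) x h → ∃ λ ℓ → l ≡ lit x ℓ (not (h ℓ))
  ∈-pigeonLits⁻ x h l∈ with ∈-map⁻ _ l∈
  ... | ℓ , _ , e = ℓ , e

  ∈-pigeonLits⁺ : ∀ x h ℓ → lit x ℓ (not (h ℓ)) ∈ pigeonLits k (2 ^ k) x h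
  ∈-pigeonLits⁺ x h ℓ = ∈-map⁺ _ (∈-allFin ℓ)

  ∈-axiom⁻ : ∀ x y h {l} → l ∈ pigeonLits k (2 ^ k) x h ++ pigeonLits k (2 ^ k) y h →
             ∃₂ λ z ℓ → (z ≡ x ⊎ z ≡ y) × l ≡ lit z ℓ (not (h ℓ))
  ∈-axiom⁻ x y h l∈ with ∈-++⁻ (pigeonLits k (2 ^ k) x h) l∈
  ... | inj₁ p = let ℓ , e = ∈-pigeonLits⁻ x h p in x , ℓ , inj₁ refl , e
  ... | inj₂ p = let ℓ , e = ∈-pigeonLits⁻ y h p in y , ℓ , inj₂ refl , e

  -- The ban on new variables enters here: variables are arbitrary pairs of numbers, and only those
  -- of the principle are bits of an actual pigeon.
  var-form : ∀ {v} → VarOf (bitPHP k) v → ∃₂ λ x ℓ → ∀ b → (v , b) ≡ lit x ℓ b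
  var-form (_ , (x , y , _ , h , refl) , b , v∈) with ∈-axiom⁻ x y h v∈
  ... | z , ℓ , _ , e = z , ℓ , λ b → cong (_, b) (,-injectiveˡ e)

  -- The hole h read off here is compatible with making L true and C ∖ L false,
  -- so an axiom on x, h and an unmentioned pigeon would refute blockedness.
  module _ {Γ : Formula Var} (axioms⊆Γ : ∀ {D} → bitPHP k D → Γ D)
           {C : Clause Var} (C-clause : IsClause C) (C-local : Local C) where

    sbc-mentions : IsSBC Γ C → ∀ y → Mentions C y
    sbc-mentions (L , ((v , b) , l∈L) , L⊆C , blocked) y with var-form (C-local v b (L⊆C _ l∈L))
    ... | x , ℓ₀ , v-form with x Fin.≟ y
    ...   | yes refl = ℓ₀ , b , subst (_∈ C) (v-form b) (L⊆C _ l∈L)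
    ...   | no x≢y with mentions? C y
    ...     | yes m = m
    ...     | no ¬m = contradiction (blocked axiom (axioms⊆Γ (x , y , x≢y , h , refl)) meets disjoint) untaut
      where
      -- The bit makes a literal of `L` true if there is one, and otherwise falsifies the literal of
      -- `C`; where `C` has none, it defaults to `true`. The first property keeps the axiom away
      -- from `L` on `x`, the second keeps the rest of `C` from clashing with the axiom.
      choose : ∀ ℓ → ∃ λ c → lit x ℓ (not c) ∉ L × (lit x ℓ c ∈ C → lit x ℓ c ∈ L)
      choose ℓ with lit x ℓ true ∈ˡ? L | lit x ℓ false ∈ˡ? L | lit x ℓ true ∈ˡ? C
      ... | yes t | _     | _     = true , (λ f → C-clause (_ , L⊆C _ t , L⊆C _ f)) , λ _ → t
      ... | no _  | yes f | _     = false , (λ t → C-clause (_ , L⊆C _ t , L⊆C _ f)) , λ _ → f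
      ... | no ¬t | no _  | yes t = false , ¬t , λ f → contradiction (_ , t , f) C-clause
      ... | no _  | no ¬f | no ¬t = true , ¬f , λ t → contradiction t ¬t
      h : Fin k → Bool
      h ℓ = proj₁ (choose ℓ)
      axiom : Clause Var
      axiom = pigeonLits k (2 ^ k) x h ++ pigeonLits k (2 ^ k) y h
      l₀∈L : lit x ℓ₀ b ∈ L
      l₀∈L = subst (_∈ L) (v-form b) l∈L
      h-ℓ₀ : b ≡ h ℓ₀
      h-ℓ₀ = trans (Bool.¬-not λ e → proj₁ (proj₂ (choose ℓ₀)) (subst (λ c → lit x ℓ₀ c ∈ L) e l₀∈L)) (Bool.not-involutive _)
      meets : Σ (Lit Var) λ l → l ∈ axiom × neg l ∈ L
      meets = lit x ℓ₀ (not (h ℓ₀)) , ∈-++⁺ˡ (∈-pigeonLits⁺ x h ℓ₀) ,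
        subst (_∈ L) (trans (cong (lit x ℓ₀) h-ℓ₀) (sym (neg-neg (lit x ℓ₀ (h ℓ₀))))) l₀∈L
      disjoint : ∀ l → l ∈ axiom → l ∉ L
      disjoint l l∈ l∈L with ∈-axiom⁻ x y h l∈
      ... | _ , ℓ , inj₁ refl , refl = proj₁ (proj₂ (choose ℓ)) l∈L
      ... | _ , ℓ , inj₂ refl , refl = ¬m (ℓ , _ , L⊆C _ l∈L)
      clash : ∀ l → l ∈ C → l ∉ L → neg l ∉ axiom
      clash l l∈C l∉L n∈ with ∈-axiom⁻ x y h n∈
      ... | _ , ℓ , z , e with trans (sym (neg-neg l)) (trans (cong neg e) (neg-neg (lit _ ℓ (h ℓ))))
      clash l l∈C l∉L n∈ | _ , ℓ , inj₁ refl , e | refl = l∉L (proj₂ (proj₂ (choose ℓ)) l∈C)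
      clash l l∈C l∉L n∈ | _ , ℓ , inj₂ refl , e | refl = ¬m (ℓ , _ , l∈C)
      untaut : ¬ TautP (λ l → (l ∈ C × l ∉ L) ⊎ (l ∈ axiom × neg l ∉ L))
      untaut (l , inj₁ (p , _) , inj₁ (q , _)) = C-clause (l , p , q)
      untaut (l , inj₁ (p , ¬p) , inj₂ (q , _)) = clash l p ¬p q
      untaut (l , inj₂ (p , _) , inj₁ (q , ¬q)) = clash (neg l) q ¬q (subst (_∈ axiom) (sym (neg-neg l)) p)
      -- Both pigeons of the axiom share `h`, so the sign of a literal is determined by its bit
      -- position and no complementary pair can occur.
      untaut (l , inj₂ (p , _) , inj₂ (q , _)) with ∈-axiom⁻ x y h p | ∈-axiom⁻ x y h q
      ... | z , ℓ , _ , refl | z′ , ℓ′ , _ , e with lit-injective {z} {ℓ} {_} {z′} {ℓ′} e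
      ...   | refl , refl , f = Bool.not-¬ refl (sym f)

  -- Matchings as partial assignments

  Satisfies : Clause Var → Pair → Set
  Satisfies C (x , h) = ∃ λ ℓ → lit x ℓ (lookup h ℓ) ∈ C

  opaque

    satisfies? : ∀ C → Decidable (Satisfies C)
    satisfies? C (x , h) = Fin.any? λ ℓ → lit x ℓ (lookup h ℓ) ∈ˡ? C

  Distinct : Pair → Pair → Set
  Distinct p q = proj₁ p ≢ proj₁ q × proj₂ p ≢ proj₂ q

  Matching : List Pair → Set
  Matching = AllPairs Distinct

  pigeons-unique : ∀ {α} → Matching α → Unique (map proj₁ α)
  pigeons-unique m = AllPairs.map⁺ (AllPairs.map proj₁ m)

  holes-unique : ∀ {α} → Matching α → Unique (map proj₂ α)
  holes-unique m = AllPairs.map⁺ (AllPairs.map proj₂ m)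

  extend : ∀ {α x h} → Matching α → x ∉ map proj₁ α → h ∉ map proj₂ α → Matching ((x , h) ∷ α)
  extend m x∉ h∉ = All.tabulate (λ p∈ → (λ { refl → x∉ (∈-map⁺ proj₁ p∈) }) , (λ { refl → h∉ (∈-map⁺ proj₂ p∈) })) ∷ m

  Matching-lookup : ∀ {α p q} → Matching α → p ∈ α → q ∈ α → p ≡ q ⊎ Distinct p q
  Matching-lookup (_ ∷ _) (here refl) (here refl) = inj₁ refl
  Matching-lookup (d ∷ _) (here refl) (there q) = inj₂ (All.lookup d q)
  Matching-lookup (d ∷ _) (there p) (here refl) = let a , b = All.lookup d p in inj₂ (a ∘ sym , b ∘ sym)
  Matching-lookup (_ ∷ m) (there p) (there q) = Matching-lookup m p q

  same-hole : ∀ {α x h h′} → Matching α → (x , h) ∈ α → (x , h′) ∈ α → h ≡ h′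
  same-hole m p q with Matching-lookup m p q
  ... | inj₁ refl = refl
  ... | inj₂ (≢x , _) = contradiction refl ≢x

  same-pigeon : ∀ {α x y h} → Matching α → (x , h) ∈ α → (y , h) ∈ α → x ≡ y
  same-pigeon m p q with Matching-lookup m p q
  ... | inj₁ refl = refl
  ... | inj₂ (_ , ≢h) = contradiction refl ≢h

  -- A matching sets all bits of each matched pigeon at once; literals on other pigeons stay
  -- undecided and do not count as falsified.
  FalsifiesLit : List Pair → Lit Var → Set
  FalsifiesLit α l = ∃ λ (p : Pair) → p ∈ α × ∃ λ ℓ → l ≡ lit (proj₁ p) ℓ (not (lookup (proj₂ p) ℓ))

  Falsifies : List Pair → Clause Var → Set
  Falsifies α C = ∀ l → l ∈ C → FalsifiesLit α l

  falsifies-not-satisfies : ∀ {α C p} → Matching α → Falsifies α C → p ∈ α → ¬ Satisfies C p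
  falsifies-not-satisfies {p = x , h} m f p∈ (ℓ , l∈) with f _ l∈
  ... | (y , h′) , q∈ , ℓ′ , e with lit-injective {x} {ℓ} {_} {y} {ℓ′} e
  ...   | refl , refl , e′ rewrite same-hole m p∈ q∈ = Bool.not-¬ refl e′

  -- Falsifying all `k` literals of a pigeon places it exactly in the hole `h`, so both pigeons of
  -- the axiom would share that hole. The argument `Fin k` excludes `k = 0`, where the axiom is
  -- empty and falsified by everything.
  axiom-not-falsified : Fin k → ∀ {α C} → Matching α → bitPHP k C → ¬ Falsifies α C
  axiom-not-falsified ℓ₀ {α} m (x , y , x≢y , h , refl) f =
    x≢y (same-pigeon m (in-hole x (λ ℓ → f _ (∈-++⁺ˡ (∈-pigeonLits⁺ x h ℓ))))
                       (in-hole y (λ ℓ → f _ (∈-++⁺ʳ _ (∈-pigeonLits⁺ y h ℓ)))))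
    where
    at : ∀ z → (∀ ℓ → FalsifiesLit α (lit z ℓ (not (h ℓ)))) → ∀ ℓ → ∃ λ t → (z , t) ∈ α × lookup t ℓ ≡ h ℓ
    at z g ℓ with g ℓ
    ... | (z′ , t) , t∈ , ℓ′ , e with lit-injective {z} {ℓ} {_} {z′} {ℓ′} e
    ...   | refl , refl , e′ = t , t∈ , Bool.not-injective (sym e′)
    in-hole : ∀ z → (∀ ℓ → FalsifiesLit α (lit z ℓ (not (h ℓ)))) → (z , tabulate h) ∈ α
    -- The bit `ℓ₀` supplies some hole of `z`; every other bit yields the same hole, because `z` is
    -- matched only once.
    in-hole z g with at z g ℓ₀
    ... | t , t∈ , _ = subst (λ u → (z , u) ∈ α) (trans (sym (tabulate∘lookup t)) (tabulate-cong agree)) t∈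
      where
      agree : ∀ ℓ → lookup t ℓ ≡ h ℓ
      agree ℓ with at z g ℓ
      ... | u , u∈ , e rewrite same-hole m t∈ u∈ = e

  opaque

    _∈ᵖ?_ : (p : Pair) (α : List Pair) → Dec (p ∈ α)
    _∈ᵖ?_ = DecMembership._∈?_ (≡-dec Fin._≟_ (Vec.≡-dec Bool._≟_))

  free-hole : ∀ {α} → Matching α → length α < 2 ^ k → ∃ λ h → h ∉ map proj₂ α
  free-hole {α} m α<2^k with ∃-complement (holes-unique m) (λ {h} _ → ∈-allHoles h)
  ... | h ∷ _ , p = h , complement-∉ (allHoles-unique k) p (here refl)
  ... | [] , p = contradiction full (<⇒≢ α<2^k)
    where
    open ≡-Reasoning
    full : length α ≡ 2 ^ k
    full = begin
      length α                          ≡⟨ length-map proj₂ α ⟨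
      length (map proj₂ α)              ≡⟨ +-identityʳ _ ⟨
      length (map proj₂ α) + 0          ≡⟨ length-++ (map proj₂ α) ⟨
      length (map proj₂ α ++ [])        ≡⟨ ↭-length p ⟨
      length (allHoles k)               ≡⟨ length-allHoles k ⟩
      2 ^ k                             ∎

  cover : ∀ {α} → Matching α → length α < 2 ^ k → ∀ x →
          ∃ λ β → Matching β × (∀ {p} → p ∈ α → p ∈ β) × ∃ λ h → (x , h) ∈ β
  cover {α} m α<2^k x with DecMembership._∈?_ Fin._≟_ x (map proj₁ α)
  ... | yes x∈ with ∈-map⁻ proj₁ x∈
  ...   | (_ , h) , p∈ , refl = α , m , id , h , p∈
  cover {α} m α<2^k x | no x∉ = let h , h∉ = free-hole m α<2^k in
    (x , h) ∷ α , extend m x∉ h∉ , there , h , here refl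

  -- The pairs of α outside ρ on pigeons that C does not mention are dropped, to
  -- make room for the queried pigeon.
  query : ∀ {ρ α C} → length ρ + width C < 2 ^ k → Matching α → (∀ {p} → p ∈ ρ → p ∈ α) → Falsifies α C → ∀ x →
          ∃ λ β → Matching β × (∀ {p} → p ∈ ρ → p ∈ β) × Falsifies β C × ∃ λ h → (x , h) ∈ β
  query {ρ} {α} {C} narrow m ρ⊆α f x =
    let β , mβ , α′⊆β , x∈β = cover m′ (≤-<-trans short narrow) x in
    β , mβ , (λ p∈ → α′⊆β (∈-filter⁺ keep? (ρ⊆α p∈) (inj₁ p∈))) ,
    (λ l l∈ → let p , p∈ , ℓ , e = f l l∈ in
      p , α′⊆β (∈-filter⁺ keep? p∈ (inj₂ (ℓ , _ , subst (_∈ C) e l∈))) , ℓ , e) ,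
    x∈β
    where
    Keep : Pair → Set
    Keep p = p ∈ ρ ⊎ Mentions C (proj₁ p)
    keep? : Decidable Keep
    keep? p = (p ∈ᵖ? ρ) ⊎-dec mentions? C (proj₁ p)
    α′ : List Pair
    α′ = filter keep? α
    m′ : Matching α′
    m′ = AllPairs.filter⁺ keep? m
    bound : List Pigeon
    bound = map proj₁ ρ ++ filter (mentions? C) allPigeons
    α′⊆bound : ∀ {y} → y ∈ map proj₁ α′ → y ∈ bound
    α′⊆bound y∈ with ∈-map⁻ proj₁ y∈
    ... | p , p∈ , refl with ∈-filter⁻ keep? {xs = α} p∈
    ...   | _ , inj₁ p∈ρ = ∈-++⁺ˡ (∈-map⁺ proj₁ p∈ρ)
    ...   | _ , inj₂ men = ∈-++⁺ʳ (map proj₁ ρ) (∈-filter⁺ (mentions? C) (∈-allFin _) men)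
    short : length α′ ≤ length ρ + width C
    short = begin
      length α′                        ≡⟨ length-map proj₁ α′ ⟨
      length (map proj₁ α′)            ≤⟨ Unique-length-≤ (pigeons-unique m′) α′⊆bound ⟩
      length bound                     ≡⟨ length-++ (map proj₁ ρ) ⟩
      length (map proj₁ ρ) + width C   ≡⟨ cong (_+ width C) (length-map proj₁ ρ) ⟩
      length ρ + width C               ∎
      where open ≤-Reasoning

  mentions-all⇒width : ∀ {C} → (∀ x → Mentions C x) → width C ≡ suc (2 ^ k)
  mentions-all⇒width {C} all = trans (cong length (filter-all (mentions? C) (All.universal all allPigeons)))
                                     (length-tabulate {n = suc (2 ^ k)} id)

  -- The hole of `x` decides the pivot. The premise whose pivot literal becomes false is falsified,
  -- since its other literals lie in `E`.
  falsifies-premise : ∀ {E C₁ C₂ α x ℓ h b} → (x , h) ∈ α → Falsifies α E →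
    (∀ l → (l ∈ C₁ × l ≢ lit x ℓ b) ⊎ (l ∈ C₂ × l ≢ neg (lit x ℓ b)) → l ∈ E) →
    Falsifies α C₁ ⊎ Falsifies α C₂
  falsifies-premise {x = x} {ℓ} {h} {b} x∈ f E⊇ with lookup h ℓ Bool.≟ b
  ... | yes h≡b = inj₂ λ l l∈ → case l ≟ˡ neg (lit x ℓ b) of λ where
          (yes refl) → (x , h) , x∈ , ℓ , cong (lit x ℓ ∘ not) (sym h≡b)
          (no l≢) → f l (E⊇ l (inj₂ (l∈ , l≢)))
  ... | no h≢b = inj₁ λ l l∈ → case l ≟ˡ lit x ℓ b of λ where
          (yes refl) → (x , h) , x∈ , ℓ , cong (lit x ℓ) (Bool.¬-not (h≢b ∘ sym))
          (no l≢) → f l (E⊇ l (inj₁ (l∈ , l≢)))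

  -- Refutations whose wide clauses are satisfied by a matching

  module Refutation (s : ℕ) (2^k≡8s : 2 ^ k ≡ 8 * s) (s>0 : 0 < s) (ℓ₀ : Fin k) where

    -- The threshold serves both sides: a clause below it, together with `s` pairs of `ρ`, leaves
    -- one of the `8 * s` holes free, and a clause at or above it still mentions `6 * s` pigeons
    -- outside `ρ`.
    Wide : Clause Var → Set
    Wide C = 7 * s ≤ width C

    module _ {ρ : List Pair} (ρ-short : length ρ ≤ s) where

      -- Induction from the latest clause back to the axioms. The matching `α` is quantified inside
      -- because a resolution step passes to a different extension of `ρ`.
      not-falsified : ∀ cs → ValidSteps (bitPHP k) cs → (∀ {C} → C ∈ cs → Local C) →
        (∀ {C} → C ∈ cs → Wide C → ∃ λ p → p ∈ ρ × Satisfies C p) →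
        ∀ {D} → (bitPHP k ∪ᶠ cs) D → ∀ {α} → Matching α → (∀ {p} → p ∈ ρ → p ∈ α) → ¬ Falsifies α D
      not-falsified cs _ _ _ (inj₁ ax) m _ = axiom-not-falsified ℓ₀ m ax
      not-falsified (C ∷ cs) (v , _) local wide (inj₂ (there D∈)) =
        not-falsified cs v (local ∘ there) (wide ∘ there) (inj₂ D∈)
      not-falsified (C ∷ cs) (v , C-clause , derivation) local wide (inj₂ (here refl)) {α} m ρ⊆α f
        with 7 * s ≤? width C
      ... | yes w = let _ , p∈ , sat = wide (here refl) w in falsifies-not-satisfies m f (ρ⊆α p∈) sat
      ... | no narrow with derivation
      ...   | inj₂ (inj₁ (C₀ , C₀∈ , weaker)) =
        not-falsified cs v (local ∘ there) (wide ∘ there) C₀∈ m ρ⊆α (λ l l∈ → f l (weaker l l∈))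
      -- A set-blocked clause mentions all pigeons, so it is wide.
      ...   | inj₂ (inj₂ sbc) = narrow (begin
        7 * s         ≤⟨ *-monoˡ-≤ s (n≤1+n 7) ⟩
        8 * s         ≡⟨ 2^k≡8s ⟨
        2 ^ k         ≤⟨ n≤1+n _ ⟩
        suc (2 ^ k)   ≡⟨ mentions-all⇒width {C} (sbc-mentions inj₁ C-clause (local (here refl)) sbc) ⟨
        width C       ∎)
        where open ≤-Reasoning
      ...   | inj₁ (C₁ , C₂ , C₁∈ , C₂∈ , (u , b) , u∈C₁ , ū∈C₂ , char , _) = conclude
        where
        previous : ∀ {D} → (bitPHP k ∪ᶠ cs) D → ∀ {α} → Matching α → (∀ {p} → p ∈ ρ → p ∈ α) → ¬ Falsifies α D
        previous = not-falsified cs v (local ∘ there) (wide ∘ there)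
        -- The pivot need not occur in the resolvent, so its form has to come from a premise.
        var : ∀ {D c} → (bitPHP k ∪ᶠ cs) D → (u , c) ∈ D → VarOf (bitPHP k) u
        var (inj₁ ax) u∈ = _ , ax , _ , u∈
        var (inj₂ D∈) u∈ = local (there D∈) _ _ u∈
        room : length ρ + width C < 2 ^ k
        room = subst (length ρ + width C <_) (sym 2^k≡8s) (+-mono-≤-< ρ-short (≰⇒> narrow))
        conclude : _
        conclude with var-form (var C₁∈ u∈C₁)
        ... | x , ℓ , u-form with query {C = C} room m ρ⊆α f x
        ...   | β , mβ , ρ⊆β , fβ , h , x∈β
          with falsifies-premise {C} {C₁} {C₂} {b = b} x∈β fβ (λ l → proj₂ (char l) ∘ subst (λ y → (l ∈ C₁ × l ≢ y) ⊎ (l ∈ C₂ × l ≢ neg y)) (sym (u-form b)))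
        ...     | inj₁ f₁ = previous C₁∈ mβ ρ⊆β f₁
        ...     | inj₂ f₂ = previous C₂∈ mβ ρ⊆β f₂

    -- Greedy choice of the matching

    count-bit-4s : ∀ ℓ b → count (bit? ℓ b) (allHoles k) ≡ 4 * s
    count-bit-4s ℓ b = *-cancelˡ-≡ _ _ 2 (trans (count-bit ℓ b) (trans 2^k≡8s (*-assoc 2 4 s)))

    -- Averaging over free pigeons and free holes. A wide clause mentions at least `6 * s` free
    -- pigeons, and a literal on such a pigeon is made true by at least `3 * s` free holes. So each
    -- clause is satisfied by at least a quarter of the pairs, and some pair satisfies a quarter of
    -- the clauses.
    best-pair : ∀ {ρ} → Matching ρ → length ρ ≤ s → ∀ C U → All Wide (C ∷ U) →
      ∃ λ p → Matching (p ∷ ρ) × length (C ∷ U) ≤ 4 * count (λ D → satisfies? D p) (C ∷ U)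
    best-pair {ρ} m ρ-short C U wide
      with ∃-complement (pigeons-unique m) (λ {x} _ → ∈-allFin x) | ∃-complement (holes-unique m) (λ {h} _ → ∈-allHoles h)
    ... | X , pX | H , pH =
      let p , p∈ , large = averaging 4 (length V) (λ p → count (λ D → satisfies? D p) V) P P>0 total
          x∈ , h∈ = ∈-cartesianProduct⁻ X H p∈
      in p , extend m (complement-∉ (Unique.allFin⁺ _) pX x∈) (complement-∉ (allHoles-unique k) pH h∈) , large
      where
      open ≤-Reasoning
      V : List (Clause Var)
      V = C ∷ U
      P : List Pair
      P = cartesianProduct X H
      mentioned : ∀ {D} → Wide D → 6 * s ≤ count (mentions? D) X
      mentioned {D} w = +-cancelˡ-≤ s _ _ (begin
        7 * s                                           ≤⟨ w ⟩
        width D                                         ≤⟨ count-complement (mentions? D) (map proj₁ ρ) pX ⟩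
        length (map proj₁ ρ) + count (mentions? D) X    ≡⟨ cong (_+ _) (length-map proj₁ ρ) ⟩
        length ρ + count (mentions? D) X                ≤⟨ +-monoˡ-≤ _ ρ-short ⟩
        s + count (mentions? D) X                       ∎)
      -- Half of the `8 * s` holes have the required bit, and `ρ` occupies at most `s` of them.
      bits : ∀ ℓ b → 3 * s ≤ count (bit? ℓ b) H
      bits ℓ b = +-cancelˡ-≤ s _ _ (begin
        4 * s                                           ≡⟨ count-bit-4s ℓ b ⟨
        count (bit? ℓ b) (allHoles k)                   ≤⟨ count-complement (bit? ℓ b) (map proj₂ ρ) pH ⟩
        length (map proj₂ ρ) + count (bit? ℓ b) H       ≡⟨ cong (_+ _) (length-map proj₂ ρ) ⟩
        length ρ + count (bit? ℓ b) H                   ≤⟨ +-monoˡ-≤ _ ρ-short ⟩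
        s + count (bit? ℓ b) H                          ∎)
      satisfying : ∀ {D} → Wide D → 6 * s * (3 * s) ≤ count (satisfies? D) P
      satisfying {D} w = ≤-trans (*-monoˡ-≤ (3 * s) (mentioned {D} w))
        (count-cartesianProduct (satisfies? D) (mentions? D) H (3 * s)
          (λ {x} (ℓ , b , l∈) → ≤-trans (bits ℓ b)
            (count-mono (bit? ℓ b) (λ h → satisfies? D (x , h)) (λ { refl → ℓ , l∈ }) H)) X)
      length-P : length P ≤ 4 * (6 * s * (3 * s))
      length-P = begin
        length P                       ≡⟨ length-cartesianProduct X H ⟩
        length X * length H            ≤⟨ *-mono-≤ (complement-≤ (map proj₁ ρ) pX) (complement-≤ (map proj₂ ρ) pH) ⟩
        length allPigeons * length (allHoles k)
          ≡⟨ cong₂ _*_ (trans (length-tabulate {n = suc (2 ^ k)} id) (cong suc 2^k≡8s)) (trans (length-allHoles k) 2^k≡8s) ⟩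
        -- The one extra pigeon is absorbed by `0 < s`.
        suc (8 * s) * (8 * s)          ≤⟨ *-monoˡ-≤ (8 * s) (+-monoˡ-≤ (8 * s) s>0) ⟩
        9 * s * (8 * s)                ≡⟨ regroup s ⟩
        4 * (6 * s * (3 * s))          ∎
        where
        complement-≤ : ∀ {A : Set} (xs : List A) {ys zs : List A} → ys ↭ xs ++ zs → length zs ≤ length ys
        complement-≤ xs p = ≤-trans (m≤n+m _ (length xs)) (≤-reflexive (sym (trans (↭-length p) (length-++ xs))))
      -- The pairs that satisfy the first clause show that there is something to average over.
      P>0 : 0 < length P
      P>0 = begin
        1                       ≤⟨ *-mono-≤ (*-mono-≤ {1} {6} (s≤s z≤n) s>0) (*-mono-≤ {1} {3} (s≤s z≤n) s>0) ⟩
        6 * s * (3 * s)         ≤⟨ satisfying {C} (All.head wide) ⟩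
        count (satisfies? C) P  ≤⟨ length-filter (satisfies? C) P ⟩
        length P                ∎
      total : length P * length V ≤ 4 * sum (map (λ p → count (λ D → satisfies? D p) V) P)
      total = begin
        length P * length V                              ≤⟨ *-monoˡ-≤ (length V) length-P ⟩
        4 * (6 * s * (3 * s)) * length V                 ≡⟨ trans (*-assoc 4 (6 * s * (3 * s)) _) (cong (4 *_) (*-comm (6 * s * (3 * s)) _)) ⟩
        4 * (length V * (6 * s * (3 * s)))
          ≤⟨ *-monoʳ-≤ 4 (sum-≥ (λ D → count (satisfies? D) P) _ V (λ {D} D∈ → satisfying {D} (All.lookup wide D∈))) ⟩
        4 * sum (map (λ D → count (satisfies? D) P) V)   ≡⟨ cong (4 *_) (double-count satisfies? V P) ⟩
        4 * sum (map (λ p → count (λ D → satisfies? D p) V) P) ∎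

    Covered : List Pair → Clause Var → Set
    Covered ρ C = ∃ λ p → p ∈ ρ × Satisfies C p

    unsat? : ∀ p → Decidable (λ D → ¬ Satisfies D p)
    unsat? p D = ¬? (satisfies? D p)

    unsatisfied-or-covered : ∀ {p ρ U D} → D ∈ U → D ∈ filter (unsat? p) U ⊎ Covered (p ∷ ρ) D
    unsatisfied-or-covered {p} {D = D} D∈ with satisfies? D p
    ... | yes t = inj₂ (p , here refl , t)
    ... | no ¬t = inj₁ (∈-filter⁺ (unsat? p) D∈ ¬t)

    unsatisfied-few : ∀ p U → length U ≤ 4 * count (λ D → satisfies? D p) U →
                      4 * length (filter (unsat? p) U) ≤ 3 * length U
    unsatisfied-few p U large = three-quarters (count (λ D → satisfies? D p) U) (count (unsat? p) U) (length U) large (count+count-¬ (λ D → satisfies? D p) U)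

    -- One greedy round. An empty list passes through unchanged, so the number of rounds can be
    -- fixed in advance.
    shrink : ∀ {ρ} → Matching ρ → length ρ ≤ s → ∀ U → All Wide U →
      ∃₂ λ σ V → Matching σ × length σ ≤ suc (length ρ) × (∀ {p} → p ∈ ρ → p ∈ σ) × All Wide V ×
        (∀ {C} → C ∈ U → C ∈ V ⊎ Covered σ C) × 4 * length V ≤ 3 * length U
    shrink {ρ} m short [] wide = ρ , [] , m , n≤1+n _ , id , [] , inj₁ , z≤n
    shrink {ρ} m short (C ∷ U) wide =
      let p , m′ , large = best-pair m short C U wide in
      p ∷ ρ , filter (unsat? p) (C ∷ U) , m′ , ≤-refl , there ,
      All.filter⁺ (unsat? p) wide , unsatisfied-or-covered , unsatisfied-few p (C ∷ U) large

    -- A fraction of at most (3/4)^i of the wide clauses survives `i` rounds. The condition `i ≤ s`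
    -- keeps the matching short enough for each round.
    greedy : ∀ S → All Wide S → ∀ i → i ≤ s →
      ∃₂ λ ρ U → Matching ρ × length ρ ≤ i × All Wide U ×
        (∀ {C} → C ∈ S → C ∈ U ⊎ Covered ρ C) × 4 ^ i * length U ≤ 3 ^ i * length S
    greedy S wide zero _ = [] , S , [] , z≤n , wide , inj₁ , ≤-refl
    greedy S wide (suc i) i<s =
      let ρ , U , m , ρ≤i , wideU , inU , bound = greedy S wide i (<⇒≤ i<s)
          σ , V , mσ , σ≤ , ρ⊆σ , wideV , inV , step = shrink m (≤-trans ρ≤i (<⇒≤ i<s)) U wideU
          covered : ∀ {C} → C ∈ S → C ∈ V ⊎ Covered σ C
          covered C∈ = [ inV , (λ (p , p∈ , t) → inj₂ (p , ρ⊆σ p∈ , t)) ]′ (inU C∈)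
      in σ , V , mσ , ≤-trans σ≤ (s≤s ρ≤i) , wideV , covered , iterate-bound i step bound

    size-bound : ∀ cs → IsSBCMinusProof (bitPHP k) cs → 4 ^ s ≤ 3 ^ s * proofSize cs
    size-bound cs ((valid , .[] , ⊥∈ , refl) , local) = finish (greedy S wideS s ≤-refl)
      where
      open ≤-Reasoning
      wide? : Decidable Wide
      wide? C = 7 * s ≤? width C
      S : List (Clause Var)
      S = filter wide? cs
      wideS : All Wide S
      wideS = All.all-filter wide? cs
      finish : (∃₂ λ ρ U → Matching ρ × length ρ ≤ s × All Wide U ×
                 (∀ {C} → C ∈ S → C ∈ U ⊎ Covered ρ C) × 4 ^ s * length U ≤ 3 ^ s * length S) →
               4 ^ s ≤ 3 ^ s * proofSize cs
      -- No wide clause survives, yet `ρ` vacuously falsifies the derived empty clause.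
      finish (ρ , [] , m , short , _ , inU , _) =
        contradiction (λ _ ()) (not-falsified short cs valid (λ C∈ v b → local _ C∈ v b) covered ⊥∈ m id)
        where
        covered : ∀ {C} → C ∈ cs → Wide C → Covered ρ C
        covered C∈ w = [ (λ ()) , id ]′ (inU (∈-filter⁺ wide? C∈ w))
      -- A surviving clause gives 1 ≤ (3/4)^s times the number of wide clauses.
      finish (ρ , C ∷ U , _ , _ , _ , _ , bound) = begin
        4 ^ s                      ≤⟨ m≤m*n (4 ^ s) (suc (length U)) ⟩
        4 ^ s * suc (length U)     ≤⟨ bound ⟩
        3 ^ s * length S           ≤⟨ *-monoʳ-≤ (3 ^ s) (m≤n⇒m≤1+n (length-filter wide? cs)) ⟩
        3 ^ s * proofSize cs       ∎

-- From (4/3)^s to an exponential bound in n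

n<2^1+⌊log₂n⌋ : ∀ n → n < 2 ^ suc ⌊log₂ n ⌋
n<2^1+⌊log₂n⌋ n = ≰⇒> λ 2^≤n → 1+n≰n (subst (_≤ ⌊log₂ n ⌋) (⌊log₂[2^n]⌋≡n (suc ⌊log₂ n ⌋)) (⌊log₂⌋-mono-≤ 2^≤n))

-- 2 · 27 ≤ 64
2^s*[3^s]³≤[4^s]³ : ∀ s → 2 ^ s * (3 ^ s) ^ 3 ≤ (4 ^ s) ^ 3
2^s*[3^s]³≤[4^s]³ zero = ≤-refl
2^s*[3^s]³≤[4^s]³ (suc s) = begin
  2 ^ suc s * (3 ^ suc s) ^ 3     ≡⟨ left (2 ^ s) (3 ^ s) ⟩
  54 * (2 ^ s * (3 ^ s) ^ 3)      ≤⟨ *-mono-≤ (m≤m+n 54 10) (2^s*[3^s]³≤[4^s]³ s) ⟩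
  64 * (4 ^ s) ^ 3                ≡⟨ right (4 ^ s) ⟨
  (4 ^ suc s) ^ 3                 ∎
  where
  open ≤-Reasoning
  left : ∀ b a → 2 * b * (3 * a * (3 * a * (3 * a * 1))) ≡ 54 * (b * (a * (a * (a * 1))))
  left = solve-∀
  right : ∀ a → 4 * a * (4 * a * (4 * a * 1)) ≡ 64 * (a * (a * (a * 1)))
  right = solve-∀

-- Cubing suffices to pass from base 4/3 to base 2, as 64/27 exceeds 2.
2^s≤N³ : ∀ s {N} → 4 ^ s ≤ 3 ^ s * N → 2 ^ s ≤ N ^ 3
2^s≤N³ s {N} bound = *-cancelʳ-≤ (2 ^ s) (N ^ 3) ((3 ^ s) ^ 3) {{m^n≢0 (3 ^ s) 3 {{m^n≢0 3 s}}}} (begin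
  2 ^ s * (3 ^ s) ^ 3    ≤⟨ 2^s*[3^s]³≤[4^s]³ s ⟩
  (4 ^ s) ^ 3            ≤⟨ ^-monoˡ-≤ 3 bound ⟩
  (3 ^ s * N) ^ 3        ≡⟨ cube (3 ^ s) N ⟩
  N ^ 3 * (3 ^ s) ^ 3    ∎)
  where
  open ≤-Reasoning
  cube : ∀ a b → a * b * (a * b * (a * b * 1)) ≡ b * (b * (b * 1)) * (a * (a * (a * 1)))
  cube = solve-∀

-- The exponent is 3 · 16: the cube changes the base, and 16 is the ratio of 2^(k+1), which exceeds
-- `n`, to `s`. This amounts to c = 1/48.
2^n≤N⁴⁸ : ∀ s n N → n ≤ s * 16 → 4 ^ s ≤ 3 ^ s * N → 2 ^ n ≤ N ^ 48
2^n≤N⁴⁸ s n N n≤16s bound = begin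
  2 ^ n           ≤⟨ ^-monoʳ-≤ 2 n≤16s ⟩
  2 ^ (s * 16)    ≡⟨ ^-*-assoc 2 s 16 ⟨
  (2 ^ s) ^ 16    ≤⟨ ^-monoˡ-≤ 16 (2^s≤N³ s bound) ⟩
  (N ^ 3) ^ 16    ≡⟨ ^-*-assoc N 3 16 ⟩
  N ^ 48          ∎
  where open ≤-Reasoning

-- Opaque, since conversion checking must not unfold proofSize cs ^ 48.
opaque

  polynomial-bound : ∃ λ d → ∀ s n N → n ≤ s * 16 → 4 ^ s ≤ 3 ^ s * N → 2 ^ n ≤ N ^ suc d
  polynomial-bound = 47 , 2^n≤N⁴⁸

-- Writing `k` as `3 + j` makes `s = 2 ^ j` an exact eighth of the number of holes.
sbc⁻-lower-bound : ∀ k n → (∃ λ j → 3 + j ≡ k) → n < 2 ^ suc k →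
                   ∀ cs → IsSBCMinusProof (bitPHP k) cs → 2 ^ n ≤ proofSize cs ^ suc (proj₁ polynomial-bound)
sbc⁻-lower-bound _ n (j , refl) n<2^1+k cs proof =
  proj₂ polynomial-bound s n (proofSize cs) (<⇒≤ (subst (n <_) (16s s) n<2^1+k)) (size-bound cs proof)
  where
  s : ℕ
  s = 2 ^ j
  16s : ∀ s → 2 * (2 * (2 * (2 * s))) ≡ s * 16
  16s = solve-∀
  open BitPHP.Refutation (3 + j) s (^-distribˡ-+-* 2 3 j) (m^n>0 2 j) Fin.zero

theorem1 : Σ ℕ λ d → Σ ℕ λ n₀ → (n : ℕ) → n₀ ≤ n → 2 ≤ n → (cs : List (Clause (ℕ × ℕ))) → IsSBCMinusProof (BPHP n) cs → 2 ^ n ≤ proofSize cs ^ suc d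
-- From 8 ≤ n on, the logarithm is at least 3, as the division by eight requires.
theorem1 = proj₁ polynomial-bound , 8 , λ n 8≤n _ cs proof →
  sbc⁻-lower-bound (bphpK n) n (m≤n⇒∃[o]m+o≡n (⌊log₂⌋-mono-≤ 8≤n)) (n<2^1+⌊log₂n⌋ n) cs proof
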